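{- For all integers $n\ge 0$, $$\beta_n+q\,\beta_{n+1}=\sum_{k=0}^{n}(-1)^k\frac{[k]!}{[k+2]}\,S_q(n,k).$$
   Context: Let $q$ be a positive real number, $q\neq 1$, and put $[X]:=\frac{q^X-1}{q-1}$. For an integer $k\ge 0$, $[X]_k:=[X][X-1]\cdots[X-k+1]$ (with $[X]_0=1$), and $[k]!:=[k]_k=[k][k-1]\cdots[1]$. The $q$-Stirling numbers of the second kind $S_q(n,k)$ ($n\ge k\ge 0$) are defined by the identities $$[X]^n=\sum_{k=0}^{n}q^{\frac12 k(k-1)}S_q(n,k)\,[X]_k\qquad(n\ge 0).$$ The Carlitz $q$-Bernoulli numbers $\beta_n$ ($n\ge 0$) are $$\beta_n:=(q-1)^{ -n}\sum_{k=0}^{n}(-1)^{n-k}\binom{n}{k}\frac{k+1}{[k+1]}.$$ -}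

module Defs where

open import Level using (Level; _⊔_) renaming (suc to lsuc)
open import Algebra.Apartness.Bundles using (HeytingField)
open import Algebra.Bundles using (CommutativeRing; Semiring)
import Algebra.Definitions.RawSemiring as RawSemiringDefs
import Algebra.Apartness.Properties.HeytingCommutativeRing as HCRProperties
import Algebra.Properties.Ring as RingProperties
open import Data.Fin.Base using (toℕ)
open import Data.Nat.Base as ℕ using (ℕ; zero; suc; _∸_)
open import Data.Nat.Combinatorics using (_C_)
open import Data.Product.Base using (_×_; _,_; proj₁; proj₂; ∃)
open import Data.Sum.Base using (_⊎_; inj₁; inj₂)
open import Relation.Binary.Core using (Rel)
open import Relation.Binary.Structures using (IsStrictPartialOrder)
import Relation.Binary.Reasoning.Setoid as SetoidReasoning

-- The real numbers, axiomatised constructively as a Cauchy-complete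
-- Archimedean ordered field.  Classically _#_ is just ≉, and such a field
-- is unique up to isomorphism.

record Reals c ℓ₁ ℓ₂ : Set (lsuc (c ⊔ ℓ₁ ⊔ ℓ₂)) where
  field
    heytingField : HeytingField c ℓ₁ ℓ₂

  open HeytingField heytingField public

  commutativeRing : CommutativeRing c ℓ₁
  commutativeRing = record { isCommutativeRing = isCommutativeRing }

  open CommutativeRing commutativeRing public
    using (semiring; ring)
  open RawSemiringDefs (Semiring.rawSemiring semiring) public
    using (_^_; sum)
    renaming (_×_ to _×ℕ_)

  fromℕ : ℕ → Carrier
  fromℕ n = n ×ℕ 1#

  infix 4 _<_
  field
    _<_                  : Rel Carrier ℓ₂
    isStrictPartialOrder : IsStrictPartialOrder _≈_ _<_
    #⇒<∨>                : ∀ {x y} → x # y → x < y ⊎ y < x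
    <⇒#                  : ∀ {x y} → x < y → x # y
    +-monoˡ-<            : ∀ {x y} z → x < y → x + z < y + z
    *-pos                : ∀ {x y} → 0# < x → 0# < y → 0# < x * y
    archimedean          : ∀ x → ∃ λ n → x < fromℕ n

  -- ∣ x - y ∣ < ε
  Near : Carrier → Carrier → Carrier → Set ℓ₂
  Near ε x y = x - y < ε × y - x < ε

  IsCauchy : (ℕ → Carrier) → Set (c ⊔ ℓ₂)
  IsCauchy s = ∀ ε → 0# < ε →
    ∃ λ N → ∀ i j → N ℕ.≤ i → N ℕ.≤ j → Near ε (s i) (s j)

  ConvergesTo : (ℕ → Carrier) → Carrier → Set (c ⊔ ℓ₂)
  ConvergesTo s x = ∀ ε → 0# < ε →
    ∃ λ N → ∀ i → N ℕ.≤ i → Near ε (s i) x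

  field
    complete : ∀ s → IsCauchy s → ∃ λ x → ConvergesTo s x

  open HCRProperties heytingCommutativeRing public
    using (x-0≈x; 1#0; invertibleˡ⇒#; #-congʳ; #-congˡ)

  infixl 7 _/_⟨_⟩
  _/_⟨_⟩ : (x y : Carrier) → y # 0# → Carrier
  x / y ⟨ y#0 ⟩ = x * proj₁ (#⇒invertible y#0)

  -- #⇒invertible y#0 literally inverts y - 0#; this confirms that
  -- _/_⟨_⟩ is division by y.
  /-inverse : ∀ y (y#0 : y # 0#) → y * (1# / y ⟨ y#0 ⟩) ≈ 1#
  /-inverse y y#0 = trans (*-cong (sym (x-0≈x y)) (*-identityˡ _))
                          (proj₂ (proj₂ (#⇒invertible y#0)))

  -- The upper bound is inclusive.
  sumTo : ℕ → (ℕ → Carrier) → Carrier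
  sumTo n f = sum {suc n} (λ k → f (toℕ k))

  syntax sumTo n (λ k → e) = ∑[ k ≤ n ] e

-- pow x = q^x for real x: the unique continuous homomorphism from (ℝ, +)
-- to (ℝ, ·) sending 1 to q (for q > 0).

record IsRealPower {c ℓ₁ ℓ₂} (ℝ : Reals c ℓ₁ ℓ₂)
  (q : Reals.Carrier ℝ) (pow : Reals.Carrier ℝ → Reals.Carrier ℝ)
  : Set (c ⊔ ℓ₁ ⊔ ℓ₂) where
  open Reals ℝ
  field
    pow-cong   : ∀ {x y} → x ≈ y → pow x ≈ pow y
    pow-+      : ∀ x y → pow (x + y) ≈ pow x * pow y
    pow-1      : pow 1# ≈ q
    continuous : ∀ x ε → 0# < ε →
      ∃ λ δ → 0# < δ × (∀ y → Near δ y x → Near ε (pow y) (pow x))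

module _ {c ℓ₁ ℓ₂} (ℝ : Reals c ℓ₁ ℓ₂) where
  open Reals ℝ

  module QCalculus
    (q : Carrier) (0<q : 0# < q) (q#1 : q # 1#)
    (pow : Carrier → Carrier) (isRealPower : IsRealPower ℝ q pow) where

    open IsRealPower isRealPower

    q-1#0 : q - 1# # 0#
    q-1#0 with #⇒invertible q#1
    ... | i , i*d≈1 , _ = invertibleˡ⇒# (i , trans (*-congˡ (x-0≈x _)) i*d≈1)

    [_] : Carrier → Carrier
    [ X ] = (pow X - 1#) / (q - 1#) ⟨ q-1#0 ⟩

    infix 8 [_]↓_
    [_]↓_ : Carrier → ℕ → Carrier
    [ X ]↓ zero  = 1#
    [ X ]↓ suc k = [ X ]↓ k * [ X - fromℕ k ]

    [_]! : ℕ → Carrier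
    [ k ]! = [ fromℕ k ]↓ k

    -- S n k is only constrained for k ≤ n, where these identities determine it.
    IsQStirling₂ : (ℕ → ℕ → Carrier) → Set (c ⊔ ℓ₁)
    IsQStirling₂ S = ∀ n X →
      [ X ] ^ n ≈ ∑[ k ≤ n ] (q ^ (k ℕ.* (k ∸ 1) ℕ./ 2) * S n k * [ X ]↓ k)

    private
      module < = IsStrictPartialOrder isStrictPartialOrder
      open RingProperties ring using (-‿distribʳ-*; -‿distribˡ-*; -‿involutive)
      open SetoidReasoning setoid

      0<-x : ∀ {x} → x < 0# → 0# < - x
      0<-x {x} x<0 = <.<-respˡ-≈ (-‿inverseʳ x)
        (<.<-respʳ-≈ (+-identityˡ (- x)) (+-monoˡ-< (- x) x<0))

      0<1 : 0# < 1#
      0<1 with #⇒<∨> 1#0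
      ... | inj₂ p = p
      ... | inj₁ 1<0 = <.<-respʳ-≈ -1*-1≈1 (*-pos (0<-x 1<0) (0<-x 1<0))
        where
        -1*-1≈1 : - 1# * - 1# ≈ 1#
        -1*-1≈1 = begin
          - 1# * - 1#     ≈⟨ -‿distribˡ-* 1# (- 1#) ⟨
          - (1# * - 1#)   ≈⟨ -‿cong (*-identityˡ (- 1#)) ⟩
          - (- 1#)        ≈⟨ -‿involutive 1# ⟩
          1#              ∎

      0<x+y : ∀ {x y} → 0# < x → 0# < y → 0# < x + y
      0<x+y {x} {y} 0<x 0<y =
        <.trans 0<y (<.<-respˡ-≈ (+-identityˡ y) (+-monoˡ-< y 0<x))

      q#0 : q # 0#
      q#0 = #-sym (<⇒# 0<q)

      1/q 1/d : Carrier
      1/q = 1# / q ⟨ q#0 ⟩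
      1/d = proj₁ (#⇒invertible q-1#0)

      1/q*q≈1 : 1/q * q ≈ 1#
      1/q*q≈1 = trans (*-comm _ _) (/-inverse q q#0)

      d*1/d≈1 : (q - 1#) * 1/d ≈ 1#
      d*1/d≈1 = trans (*-congˡ (sym (*-identityˡ _))) (/-inverse _ q-1#0)

      pow-suc : ∀ x → pow (1# + x) ≈ q * pow x
      pow-suc x = trans (pow-+ 1# x) (*-congʳ pow-1)

      pow-0 : pow 0# ≈ 1#
      pow-0 = begin
        pow 0#               ≈⟨ *-identityˡ _ ⟨
        1# * pow 0#          ≈⟨ *-congʳ 1/q*q≈1 ⟨
        1/q * q * pow 0#     ≈⟨ *-assoc _ _ _ ⟩
        1/q * (q * pow 0#)   ≈⟨ *-congˡ (pow-suc 0#) ⟨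
        1/q * pow (1# + 0#)  ≈⟨ *-congˡ (pow-cong (+-identityʳ 1#)) ⟩
        1/q * pow 1#         ≈⟨ *-congˡ pow-1 ⟩
        1/q * q              ≈⟨ 1/q*q≈1 ⟩
        1#                   ∎

      [0]≈0 : [ 0# ] ≈ 0#
      [0]≈0 = trans (*-congʳ (trans (+-congʳ pow-0) (-‿inverseʳ 1#))) (zeroˡ _)

      [1+x] : ∀ x → [ 1# + x ] ≈ 1# + q * [ x ]
      [1+x] x = begin
        (pow (1# + x) - 1#) * 1/d                        ≈⟨ *-congʳ (+-congʳ (pow-suc x)) ⟩
        (q * pow x - 1#) * 1/d                           ≈⟨ *-congʳ split ⟨
        ((q - 1#) + q * (pow x - 1#)) * 1/d              ≈⟨ distribʳ _ _ _ ⟩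
        (q - 1#) * 1/d + q * (pow x - 1#) * 1/d          ≈⟨ +-cong d*1/d≈1 (*-assoc _ _ _) ⟩
        1# + q * [ x ]                                   ∎
        where
        split : (q - 1#) + q * (pow x - 1#) ≈ q * pow x - 1#
        split = begin
          (q - 1#) + q * (pow x - 1#)           ≈⟨ +-comm _ _ ⟩
          q * (pow x - 1#) + (q - 1#)           ≈⟨ +-congʳ (distribˡ _ _ _) ⟩
          q * pow x + q * - 1# + (q - 1#)       ≈⟨ +-congʳ (+-congˡ (trans (sym (-‿distribʳ-* q 1#)) (-‿cong (*-identityʳ q)))) ⟩
          q * pow x + - q + (q - 1#)            ≈⟨ +-assoc _ _ _ ⟩
          q * pow x + (- q + (q - 1#))          ≈⟨ +-congˡ (+-assoc _ _ _) ⟨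
          q * pow x + (- q + q - 1#)            ≈⟨ +-congˡ (+-congʳ (-‿inverseˡ q)) ⟩
          q * pow x + (0# - 1#)                 ≈⟨ +-congˡ (+-identityˡ _) ⟩
          q * pow x - 1#                        ∎

    0<[1+_] : ∀ n → 0# < [ fromℕ (suc n) ]
    0<[1+ zero ] = <.<-respʳ-≈ (sym [1]≈1) 0<1
      where
      [1]≈1 : [ fromℕ 1 ] ≈ 1#
      [1]≈1 = begin
        [ 1# + 0# ]      ≈⟨ [1+x] 0# ⟩
        1# + q * [ 0# ]  ≈⟨ +-congˡ (trans (*-congˡ [0]≈0) (zeroʳ q)) ⟩
        1# + 0#          ≈⟨ +-identityʳ 1# ⟩
        1#               ∎
    0<[1+ suc n ] =
      <.<-respʳ-≈ (sym ([1+x] _)) (0<x+y 0<1 (*-pos 0<q 0<[1+ n ]))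

    [1+_]#0 : ∀ n → [ fromℕ (suc n) ] # 0#
    [1+ n ]#0 = #-sym (<⇒# 0<[1+ n ])

    β : ℕ → Carrier
    β n = (1# / (q - 1#) ⟨ q-1#0 ⟩) ^ n
        * ∑[ k ≤ n ] ( (- 1#) ^ (n ∸ k) * fromℕ (n C k)
                     * (fromℕ (suc k) / [ fromℕ (suc k) ] ⟨ [1+ k ]#0 ⟩))

{-# OPTIONS --safe #-}
module Submission where

-- Put Y = q^X and let L be the linear functional Yᵐ ↦ (m+1)/[m+1] on
-- polynomials in Y.  Then βₙ = L([X]ⁿ), so βₙ + q βₙ₊₁ = L([X+1] [X]ⁿ), and
-- expanding [X]ⁿ reduces the claim to the values of L at [X+1] [X]ₖ.  Since
-- L(∂F) = F′(1) for ∂F = (F(qY) - F(Y)) / ((q-1) Y), and ∂ sends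
-- [X+1] [X]ₖ₊₁ to a multiple of [X+1] [X]ₖ, these values are derivatives at
-- Y = 1 of products having a single factor that vanishes there.
-- Everything is carried out on the moment sequences m ↦ L(Yᵐ f), on which
-- [X] acts as a difference operator.

open import Defs
open import Algebra.Bundles using (CommutativeRing)
import Algebra.Properties.AbelianGroup as AbelianGroupProperties
import Algebra.Properties.Group as GroupProperties
import Algebra.Properties.Ring as RingProperties
import Algebra.Properties.Semiring.Exp as Exp
import Algebra.Properties.Semiring.Mult as Mult
import Algebra.Properties.Semiring.Mult.TCOptimised as Mult′
import Algebra.Properties.Semiring.Sum as Sum
import Algebra.Solver.Ring as RingSolver
open import Algebra.Solver.Ring.AlmostCommutativeRing
  using (fromCommutativeRing; _-Raw-AlmostCommutative⟶_)
open import Data.Fin.Base using (toℕ)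
open import Data.Integer.Base as ℤ using (ℤ; +_; -[1+_]; _⊖_)
import Data.Integer.Properties as ℤ
import Data.Maybe.Base as Maybe
open import Data.Nat.Base as ℕ using (ℕ; zero; suc; _∸_; _≤_; z≤n; s≤s)
open import Data.Nat.Combinatorics
  using (_C_; nCk≡nC[n∸k]; nCn≡1; k>n⇒nCk≡0; nCk+nC[k+1]≡[n+1]C[k+1])
open import Data.Nat.Divisibility using (divides)
import Data.Nat.DivMod as ℕ
import Data.Nat.Properties as ℕ
open import Data.Nat.Solver using (module +-*-Solver)
open import Data.Product.Base using (proj₁)
open import Data.Sign.Base as Sign using (Sign)
open import Data.Sum.Base using (inj₁; inj₂)
open import Function.Base using (_∘_)
open import Level using (_⊔_)
open import Relation.Binary.PropositionalEquality as ≡ using (_≡_)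
import Relation.Binary.Reasoning.Setoid as SetoidReasoning
open import Relation.Nullary.Decidable using (dec⇒maybe)

-- A ring solver with integer coefficients for arbitrary commutative rings.

module ℤSolver {c ℓ} (R : CommutativeRing c ℓ) where
  open CommutativeRing R hiding (zero)
  open RingProperties ring
  open AbelianGroupProperties +-abelianGroup using (⁻¹-∙-comm)
  open Mult′ semiring
  open SetoidReasoning setoid

  private
    -- The optimised multiple reduces `1 × 1#` to `1#`, so the solver constants 0 and 1 denote `0#`
    -- and `1#` definitionally.
    ⟦_⟧ᶻ : ℤ → Carrier
    ⟦ + n ⟧ᶻ      = n × 1#
    ⟦ -[1+ n ] ⟧ᶻ = - (suc n × 1#)

    ⟦⟧-cong : ∀ {i j} → i ≡ j → ⟦ i ⟧ᶻ ≈ ⟦ j ⟧ᶻ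
    ⟦⟧-cong ≡.refl = refl

    ⟦-⟧ : ∀ i → ⟦ ℤ.- i ⟧ᶻ ≈ - ⟦ i ⟧ᶻ
    ⟦-⟧ (+ zero)  = sym -0#≈0#
    ⟦-⟧ (+ suc n) = refl
    ⟦-⟧ -[1+ n ]  = sym (-‿involutive _)

    ⟦⊖⟧ : ∀ m n → ⟦ m ⊖ n ⟧ᶻ ≈ m × 1# - n × 1#
    ⟦⊖⟧ m       zero    = sym (trans (+-congˡ -0#≈0#) (+-identityʳ _))
    ⟦⊖⟧ zero    (suc n) = sym (+-identityˡ _)
    ⟦⊖⟧ (suc m) (suc n) = begin
      ⟦ suc m ⊖ suc n ⟧ᶻ                ≈⟨ ⟦⟧-cong (ℤ.[1+m]⊖[1+n]≡m⊖n m n) ⟩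
      ⟦ m ⊖ n ⟧ᶻ                        ≈⟨ ⟦⊖⟧ m n ⟩
      m × 1# - n × 1#
        ≈⟨ +-congʳ (trans (+-congʳ (-‿inverseʳ 1#)) (+-identityˡ _)) ⟨
      (1# - 1#) + m × 1# - n × 1#
        ≈⟨ +-congʳ (trans (+-assoc _ _ _) (trans (+-congˡ (+-comm _ _)) (sym (+-assoc _ _ _)))) ⟩
      1# + m × 1# - 1# - n × 1#         ≈⟨ trans (+-assoc _ _ _) (+-congˡ (⁻¹-∙-comm _ _)) ⟩
      1# + m × 1# - (1# + n × 1#)       ≈⟨ +-cong (1+× m 1#) (-‿cong (1+× n 1#)) ⟨
      suc m × 1# - suc n × 1#           ∎

    ⟦+⟧ : ∀ i j → ⟦ i ℤ.+ j ⟧ᶻ ≈ ⟦ i ⟧ᶻ + ⟦ j ⟧ᶻ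
    ⟦+⟧ (+ m)    (+ n)    = ×-homo-+ 1# m n
    ⟦+⟧ (+ m)    -[1+ n ] = ⟦⊖⟧ m (suc n)
    ⟦+⟧ -[1+ m ] (+ n)    = trans (⟦⊖⟧ n (suc m)) (+-comm _ _)
    ⟦+⟧ -[1+ m ] -[1+ n ] = begin
      ⟦ -[1+ m ] ℤ.+ -[1+ n ] ⟧ᶻ          ≈⟨ ⟦⟧-cong (ℤ.neg-distrib-+ (+ suc m) (+ suc n)) ⟨
      ⟦ ℤ.- (+ (suc m ℕ.+ suc n)) ⟧ᶻ      ≈⟨ -‿cong (×-homo-+ 1# (suc m) (suc n)) ⟩
      - (suc m × 1# + suc n × 1#)         ≈⟨ ⁻¹-∙-comm _ _ ⟨
      - (suc m × 1#) - suc n × 1#         ∎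

    ⟦*⟧ : ∀ i j → ⟦ i ℤ.* j ⟧ᶻ ≈ ⟦ i ⟧ᶻ * ⟦ j ⟧ᶻ
    ⟦*⟧ (+ m)    (+ n)    = trans (⟦⟧-cong (ℤ.+◃n≡+n (m ℕ.* n))) (×1-homo-* m n)
    ⟦*⟧ (+ m)    -[1+ n ] = begin
      ⟦ Sign.- ℤ.◃ m ℕ.* suc n ⟧ᶻ         ≈⟨ ⟦⟧-cong (ℤ.-◃n≡-n (m ℕ.* suc n)) ⟩
      ⟦ ℤ.- (+ (m ℕ.* suc n)) ⟧ᶻ          ≈⟨ ⟦-⟧ (+ (m ℕ.* suc n)) ⟩
      - ((m ℕ.* suc n) × 1#)              ≈⟨ -‿cong (×1-homo-* m (suc n)) ⟩
      - (m × 1# * suc n × 1#)             ≈⟨ -‿distribʳ-* _ _ ⟩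
      m × 1# * - (suc n × 1#)             ∎
    ⟦*⟧ -[1+ m ] (+ n)    = begin
      ⟦ Sign.- ℤ.◃ suc m ℕ.* n ⟧ᶻ         ≈⟨ ⟦⟧-cong (ℤ.-◃n≡-n (suc m ℕ.* n)) ⟩
      ⟦ ℤ.- (+ (suc m ℕ.* n)) ⟧ᶻ          ≈⟨ ⟦-⟧ (+ (suc m ℕ.* n)) ⟩
      - ((suc m ℕ.* n) × 1#)              ≈⟨ -‿cong (×1-homo-* (suc m) n) ⟩
      - (suc m × 1# * n × 1#)             ≈⟨ -‿distribˡ-* _ _ ⟩
      - (suc m × 1#) * n × 1#             ∎
    ⟦*⟧ -[1+ m ] -[1+ n ] = begin
      (suc m ℕ.* suc n) × 1#              ≈⟨ ×1-homo-* (suc m) (suc n) ⟩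
      suc m × 1# * suc n × 1#             ≈⟨ -‿involutive _ ⟨
      - - (suc m × 1# * suc n × 1#)       ≈⟨ -‿cong (-‿distribˡ-* _ _) ⟩
      - (- (suc m × 1#) * suc n × 1#)     ≈⟨ -‿distribʳ-* _ _ ⟩
      - (suc m × 1#) * - (suc n × 1#)     ∎

    homomorphism : ℤ.+-*-rawRing -Raw-AlmostCommutative⟶ fromCommutativeRing R
    homomorphism = record
      { ⟦_⟧    = ⟦_⟧ᶻ
      ; +-homo = ⟦+⟧
      ; *-homo = ⟦*⟧
      ; -‿homo = ⟦-⟧
      ; 0-homo = refl
      ; 1-homo = refl
      }

  open RingSolver ℤ.+-*-rawRing (fromCommutativeRing R) homomorphism
    (λ i j → Maybe.map ⟦⟧-cong (dec⇒maybe (i ℤ.≟ j))) public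

-- Finite sums over 0, ..., n.

module FiniteSums {c ℓ} (R : CommutativeRing c ℓ) where
  open CommutativeRing R hiding (zero)
  open Sum semiring

  -- The upper bound is inclusive.  Direct recursion, unlike an abbreviation
  -- for sum, lets unification recover f from ∑≤ n f.
  ∑≤ : ℕ → (ℕ → Carrier) → Carrier
  ∑≤ zero    f = f 0 + 0#
  ∑≤ (suc n) f = f 0 + ∑≤ n (f ∘ suc)

  ∑≤≡sum : ∀ n f → ∑≤ n f ≡ sum {suc n} (f ∘ toℕ)
  ∑≤≡sum zero    f = ≡.refl
  ∑≤≡sum (suc n) f = ≡.cong (λ s → f 0 + s) (∑≤≡sum n (f ∘ suc))

  ∑-cong-≤ : ∀ n {f g} → (∀ k → k ≤ n → f k ≈ g k) → ∑≤ n f ≈ ∑≤ n g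
  ∑-cong-≤ zero    f≈g = +-congʳ (f≈g 0 z≤n)
  ∑-cong-≤ (suc n) f≈g =
    +-cong (f≈g 0 z≤n) (∑-cong-≤ n (λ k k≤n → f≈g (suc k) (s≤s k≤n)))

  ∑-cong : ∀ n {f g} → (∀ k → f k ≈ g k) → ∑≤ n f ≈ ∑≤ n g
  ∑-cong n f≈g = ∑-cong-≤ n (λ k _ → f≈g k)

  ∑-+ : ∀ n f g → ∑≤ n (λ k → f k + g k) ≈ ∑≤ n f + ∑≤ n g
  ∑-+ n f g rewrite ∑≤≡sum n (λ k → f k + g k) | ∑≤≡sum n f | ∑≤≡sum n g =
    ∑-distrib-+ {suc n} (f ∘ toℕ) (g ∘ toℕ)

  ∑-*ˡ : ∀ n a f → ∑≤ n (λ k → a * f k) ≈ a * ∑≤ n f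
  ∑-*ˡ n a f rewrite ∑≤≡sum n (λ k → a * f k) | ∑≤≡sum n f =
    sym (*-distribˡ-sum {suc n} a (f ∘ toℕ))

  ∑-0 : ∀ n {f} → (∀ k → f k ≈ 0#) → ∑≤ n f ≈ 0#
  ∑-0 zero    f≈0 = trans (+-identityʳ _) (f≈0 0)
  ∑-0 (suc n) f≈0 = trans (+-cong (f≈0 0) (∑-0 n (f≈0 ∘ suc))) (+-identityˡ _)

-- Umbral calculus over a commutative ring in which ι inverts q - 1.

module Umbral {c ℓ} (R : CommutativeRing c ℓ) (q ι : CommutativeRing.Carrier R)
  (⟨q-1⟩ι≈1 : CommutativeRing._≈_ R
    (CommutativeRing._*_ R (CommutativeRing._-_ R q (CommutativeRing.1# R)) ι)
    (CommutativeRing.1# R)) where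

  open CommutativeRing R hiding (zero)
  open FiniteSums R
  open ℤSolver R
  open Exp semiring using (_^_)
  open Mult semiring using (×-homo-+) renaming (_×_ to _×ℕ_)
  open RingProperties ring using (-‿distribˡ-*)
  open GroupProperties +-group using () renaming (∙-cancelˡ to +-cancelˡ)
  open SetoidReasoning setoid

  private
    :1 : ∀ {n} → Polynomial n
    :1 = con (+ 1)
    :0 : ∀ {n} → Polynomial n
    :0 = con (+ 0)

  -- The solver does not know that ι inverts q - 1; z is the cofactor with which this relation
  -- enters an otherwise polynomial identity.
  modulo : ∀ {x y} z → x ≈ y + z * ((q - 1#) * ι - 1#) → x ≈ y
  modulo {x} {y} z x≈ = begin
    x                                ≈⟨ x≈ ⟩
    y + z * ((q - 1#) * ι - 1#)      ≈⟨ +-congˡ (*-congˡ (+-congʳ ⟨q-1⟩ι≈1)) ⟩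
    y + z * (1# - 1#)                ≈⟨ solve 2 (λ y z → y :+ z :* (:1 :- :1) := y) refl y z ⟩
    y                                ∎

  -- The q-integer [n] = 1 + q + ⋯ + qⁿ⁻¹ in Horner form, free of division, so that the solver can
  -- treat [n + 1] as 1 + q [n].
  ⟨_⟩ : ℕ → Carrier
  ⟨ zero ⟩  = 0#
  ⟨ suc n ⟩ = 1# + q * ⟨ n ⟩

  ⟨suc⟩ : ∀ n → ⟨ suc n ⟩ ≈ ⟨ n ⟩ + q ^ n
  ⟨suc⟩ zero    = solve 1 (λ q → :1 :+ q :* :0 := :0 :+ :1) refl q
  ⟨suc⟩ (suc n) = begin
    1# + q * ⟨ suc n ⟩               ≈⟨ +-congˡ (*-congˡ (⟨suc⟩ n)) ⟩
    1# + q * (⟨ n ⟩ + q ^ n)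
      ≈⟨ solve 3 (λ q a b → :1 :+ q :* (a :+ b) := :1 :+ q :* a :+ q :* b) refl q ⟨ n ⟩ (q ^ n) ⟩
    ⟨ suc n ⟩ + q ^ suc n            ∎

  -- Differences of interpolation nodes: they can be cancelled as soon as q and the [n] with n > 0
  -- can.
  ⟨+⟩ : ∀ m n → ⟨ m ℕ.+ n ⟩ - ⟨ m ⟩ ≈ q ^ m * ⟨ n ⟩
  ⟨+⟩ zero    n = solve 1 (λ a → a :- :0 := :1 :* a) refl ⟨ n ⟩
  ⟨+⟩ (suc m) n = begin
    1# + q * ⟨ m ℕ.+ n ⟩ - (1# + q * ⟨ m ⟩)
      ≈⟨ solve 3 (λ q a b → :1 :+ q :* a :- (:1 :+ q :* b) := q :* (a :- b)) refl q _ _ ⟩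
    q * (⟨ m ℕ.+ n ⟩ - ⟨ m ⟩)                ≈⟨ *-congˡ (⟨+⟩ m n) ⟩
    q * (q ^ m * ⟨ n ⟩)                      ≈⟨ *-assoc _ _ _ ⟨
    q ^ suc m * ⟨ n ⟩                        ∎

  ⟨⟩-closed : ∀ n → ⟨ n ⟩ ≈ (q ^ n - 1#) * ι
  ⟨⟩-closed zero    = solve 1 (λ ι → :0 := (:1 :- :1) :* ι) refl ι
  ⟨⟩-closed (suc n) = trans (+-congˡ (*-congˡ (⟨⟩-closed n)))
    (modulo (- 1#) (solve 3 (λ q ι y → :1 :+ q :* ((y :- :1) :* ι)
      := (q :* y :- :1) :* ι :+ :- :1 :* ((q :- :1) :* ι :- :1)) refl q ι (q ^ n)))

  -- Moment sequences and the transposed multiplication operators.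

  Seq : Set c
  Seq = ℕ → Carrier

  infix 4 _≋_
  _≋_ : Seq → Seq → Set ℓ
  φ ≋ ψ = ∀ m → φ m ≈ ψ m

  -- Transpose of multiplication by a Y + b, which is why all these operators are linear and
  -- commute.
  step : Carrier → Carrier → Seq → Seq
  step a b φ m = a * φ (suc m) + b * φ m

  step-cong : ∀ a b {φ ψ} → φ ≋ ψ → step a b φ ≋ step a b ψ
  step-cong a b φ≋ψ m = +-cong (*-congˡ (φ≋ψ (suc m))) (*-congˡ (φ≋ψ m))

  step-linear : ∀ a b x y φ ψ m →
    step a b (λ i → x * φ i + y * ψ i) m ≈ x * step a b φ m + y * step a b ψ m
  step-linear a b x y φ ψ m =
    solve 8 (λ a b x y f f′ g g′ →
      a :* (x :* f′ :+ y :* g′) :+ b :* (x :* f :+ y :* g)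
        := x :* (a :* f′ :+ b :* f) :+ y :* (a :* g′ :+ b :* g))
      refl a b x y (φ m) (φ (suc m)) (ψ m) (ψ (suc m))

  step-comm : ∀ a b a′ b′ φ → step a b (step a′ b′ φ) ≋ step a′ b′ (step a b φ)
  step-comm a b a′ b′ φ m =
    solve 7 (λ a b a′ b′ f g h →
      a :* (a′ :* h :+ b′ :* g) :+ b :* (a′ :* g :+ b′ :* f)
        := a′ :* (a :* h :+ b :* g) :+ b′ :* (a :* g :+ b :* f))
      refl a b a′ b′ (φ m) (φ (suc m)) (φ (suc (suc m)))

  step-∑ : ∀ a b n (c : ℕ → Carrier) (φ : ℕ → Seq) m →
    step a b (λ i → ∑≤ n (λ k → c k * φ k i)) m ≈ ∑≤ n (λ k → c k * step a b (φ k) m)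
  step-∑ a b n c φ m = begin
    a * ∑≤ n (λ k → c k * φ k (suc m)) + b * ∑≤ n (λ k → c k * φ k m)
      ≈⟨ +-cong (∑-*ˡ n a _) (∑-*ˡ n b _) ⟨
    ∑≤ n (λ k → a * (c k * φ k (suc m))) + ∑≤ n (λ k → b * (c k * φ k m))
      ≈⟨ ∑-+ n _ _ ⟨
    ∑≤ n (λ k → a * (c k * φ k (suc m)) + b * (c k * φ k m))
      ≈⟨ ∑-cong n (λ k → solve 5 (λ a b c f g → a :* (c :* g) :+ b :* (c :* f)
            := c :* (a :* g :+ b :* f))
          refl a b (c k) (φ k m) (φ k (suc m))) ⟩
    ∑≤ n (λ k → c k * step a b (φ k) m)
      ∎

  -- A sequence φ stands for the linear functional Yᵐ ↦ φ m on polynomials in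
  -- Y = q^X.  X, T and D j are the transposes of multiplication by [X],
  -- [X + 1] and [X] - [j], and ∂ is that of F ↦ (F(qY) - F(Y)) / ((q - 1) Y).
  X T ∂ : Seq → Seq
  X = step ι (- ι)
  T = step (q * ι) (- ι)
  ∂ φ zero    = 0#
  ∂ φ (suc m) = ⟨ suc m ⟩ * φ m

  D : ℕ → Seq → Seq
  D j = step ι (- (ι + ⟨ j ⟩))

  X^ : ℕ → Seq → Seq
  X^ zero    φ = φ
  X^ (suc n) φ = X (X^ n φ)

  -- Transpose of multiplication by ([X] - [j]) ⋯ ([X] - [j + k - 1]). The offset j is a parameter
  -- because the recursion removes the first factor.
  V : ℕ → ℕ → Seq → Seq
  V j zero    φ = φ
  V j (suc k) φ = D j (V (suc j) k φ)

  V-cong : ∀ j k {φ ψ} → φ ≋ ψ → V j k φ ≋ V j k ψ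
  V-cong j zero    φ≋ψ = φ≋ψ
  V-cong j (suc k) φ≋ψ = step-cong _ _ (V-cong (suc j) k φ≋ψ)

  V-step-comm : ∀ j k a b φ → step a b (V j k φ) ≋ V j k (step a b φ)
  V-step-comm j zero    a b φ m = refl
  V-step-comm j (suc k) a b φ m = trans (step-comm a b _ _ (V (suc j) k φ) m)
    (step-cong _ _ (V-step-comm (suc j) k a b φ) m)

  X≋D : ∀ j φ m → X φ m ≈ D j φ m + ⟨ j ⟩ * φ m
  X≋D j φ m = solve 4 (λ ι x f g → ι :* g :+ :- ι :* f
    := ι :* g :+ :- (ι :+ x) :* f :+ x :* f) refl ι ⟨ j ⟩ (φ m) (φ (suc m))

  T≋1+qX : ∀ φ m → T φ m ≈ φ m + q * X φ m
  T≋1+qX φ m = modulo (φ m) (solve 4 (λ q ι f g →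
    q :* ι :* g :+ :- ι :* f := f :+ q :* (ι :* g :+ :- ι :* f) :+ f :* ((q :- :1) :* ι :- :1))
    refl q ι (φ m) (φ (suc m)))

  -- The q-Leibniz rule ∂(gF) = (∂g) F + g(qY) ∂F, transposed, for g = [X] - [j + 1]: here ∂g = ι,
  -- and Y ↦ qY sends g to [X + 1] - [j + 1] = q ([X] - [j]).
  D-suc-∂ : ∀ j φ m → D (suc j) (∂ φ) m ≈ ι * φ m + q * ∂ (D j φ) m
  D-suc-∂ j φ zero =
    solve 4 (λ q ι x f →
      ι :* ((:1 :+ q :* :0) :* f) :+ :- (ι :+ x) :* :0 := ι :* f :+ q :* :0)
      refl q ι ⟨ suc j ⟩ (φ 0)
  D-suc-∂ j φ (suc m) = modulo (⟨ suc m ⟩ * φ m)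
    (solve 6 (λ q ι x y f g →
      ι :* ((:1 :+ q :* y) :* g) :+ :- (ι :+ (:1 :+ q :* x)) :* (y :* f)
        := ι :* g :+ q :* (y :* (ι :* g :+ :- (ι :+ x) :* f))
           :+ y :* f :* ((q :- :1) :* ι :- :1))
      refl q ι ⟨ j ⟩ ⟨ suc m ⟩ (φ m) (φ (suc m)))

  -- The same rule for g = [X], which Y ↦ qY sends to [X + 1].
  D-zero-∂ : ∀ φ m → D 0 (∂ φ) m ≈ ι * φ m + ∂ (T φ) m
  D-zero-∂ φ zero =
    solve 3 (λ q ι f →
      ι :* ((:1 :+ q :* :0) :* f) :+ :- (ι :+ :0) :* :0 := ι :* f :+ :0)
      refl q ι (φ 0)
  D-zero-∂ φ (suc m) =
    solve 5 (λ q ι y f g →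
      ι :* ((:1 :+ q :* y) :* g) :+ :- (ι :+ :0) :* (y :* f)
        := ι :* g :+ y :* (q :* ι :* g :+ :- ι :* f))
      refl q ι ⟨ suc m ⟩ (φ m) (φ (suc m))

  -- The q-Leibniz rule for g = ([X] - [j + 1]) ⋯ ([X] - [j + k + 1]). Substituting qY lowers every
  -- index at the price of a factor q, and ∂g is [k + 1] ι times g without its last factor.
  V-suc-∂ : ∀ j k φ m → V (suc j) (suc k) (∂ φ) m ≈
    (⟨ suc k ⟩ * ι) * V (suc j) k φ m + q ^ suc k * ∂ (V j (suc k) φ) m
  V-suc-∂ j zero φ m = begin
    D (suc j) (∂ φ) m                    ≈⟨ D-suc-∂ j φ m ⟩
    ι * φ m + q * ∂ (D j φ) m
      ≈⟨ solve 4 (λ q ι f g → ι :* f :+ q :* g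
            := ((:1 :+ q :* :0) :* ι) :* f :+ (q :* :1) :* g)
          refl q ι (φ m) (∂ (D j φ) m) ⟩
    (⟨ 1 ⟩ * ι) * φ m + q ^ 1 * ∂ (D j φ) m  ∎
  V-suc-∂ j (suc k) φ m = begin
    D (suc j) (V (suc (suc j)) (suc k) (∂ φ)) m
      ≈⟨ step-cong _ _ (V-suc-∂ (suc j) k φ) m ⟩
    D (suc j) (λ i → x * V (suc (suc j)) k φ i + y * ∂ ψ i) m
      ≈⟨ step-linear _ _ x y (V (suc (suc j)) k φ) (∂ ψ) m ⟩
    x * ψ m + y * D (suc j) (∂ ψ) m
      ≈⟨ +-congˡ (*-congˡ (D-suc-∂ j ψ m)) ⟩
    x * ψ m + y * (ι * ψ m + q * ∂ (D j ψ) m)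
      ≈⟨ solve 6 (λ q ι a y f g → a :* ι :* f :+ y :* (ι :* f :+ q :* g)
            := (a :+ y) :* ι :* f :+ q :* y :* g)
           refl q ι ⟨ suc k ⟩ y (ψ m) (∂ (D j ψ) m) ⟩
    ((⟨ suc k ⟩ + y) * ι) * ψ m + q ^ suc (suc k) * ∂ (D j ψ) m
      ≈⟨ +-congʳ (*-congʳ (*-congʳ (⟨suc⟩ (suc k)))) ⟨
    (⟨ suc (suc k) ⟩ * ι) * ψ m + q ^ suc (suc k) * ∂ (D j ψ) m
      ∎
    where
    x = ⟨ suc k ⟩ * ι
    y = q ^ suc k
    ψ = V (suc j) (suc k) φ

  -- Now the first factor of g is [X], so g(qY) = qᵏ [X + 1] [X] ⋯ ([X] - [k - 1]).
  V-zero-∂ : ∀ k φ m → V 0 (suc k) (∂ φ) m ≈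
    (⟨ suc k ⟩ * ι) * V 0 k φ m + q ^ k * ∂ (T (V 0 k φ)) m
  V-zero-∂ zero φ m = trans (D-zero-∂ φ m)
    (solve 4 (λ q ι f g → ι :* f :+ g := ((:1 :+ q :* :0) :* ι) :* f :+ :1 :* g)
      refl q ι (φ m) (∂ (T φ) m))
  V-zero-∂ (suc k) φ m = begin
    D 0 (V 1 (suc k) (∂ φ)) m
      ≈⟨ step-cong _ _ (V-suc-∂ 0 k φ) m ⟩
    D 0 (λ i → x * V 1 k φ i + y * ∂ ψ i) m
      ≈⟨ step-linear _ _ x y (V 1 k φ) (∂ ψ) m ⟩
    x * ψ m + y * D 0 (∂ ψ) m
      ≈⟨ +-congˡ (*-congˡ (D-zero-∂ ψ m)) ⟩
    x * ψ m + y * (ι * ψ m + ∂ (T ψ) m)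
      ≈⟨ solve 5 (λ ι a y f g → a :* ι :* f :+ y :* (ι :* f :+ g) := (a :+ y) :* ι :* f :+ y :* g)
           refl ι ⟨ suc k ⟩ y (ψ m) (∂ (T ψ) m) ⟩
    ((⟨ suc k ⟩ + y) * ι) * ψ m + y * ∂ (T ψ) m
      ≈⟨ +-congʳ (*-congʳ (*-congʳ (⟨suc⟩ (suc k)))) ⟨
    (⟨ suc (suc k) ⟩ * ι) * ψ m + y * ∂ (T ψ) m
      ∎
    where
    x = ⟨ suc k ⟩ * ι
    y = q ^ suc k
    ψ = V 0 (suc k) φ

  -- With [X + 1] in front, the product is a multiple of a q-falling factorial of X + 1, which ∂
  -- lowers: [X + 1] [X] ⋯ ([X] - [k]) goes to [k + 2] ι [X + 1] [X] ⋯ ([X] - [k - 1]).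
  TV-∂ : ∀ k φ → T (V 0 (suc k) (∂ φ)) 0 ≈ ⟨ suc (suc k) ⟩ * ι * T (V 0 k φ) 0
  TV-∂ k φ = begin
    T (V 0 (suc k) (∂ φ)) 0
      ≈⟨ step-cong _ _ (V-zero-∂ k φ) 0 ⟩
    T (λ i → x * V 0 k φ i + q ^ k * ∂ ψ i) 0
      ≈⟨ step-linear _ _ x (q ^ k) (V 0 k φ) (∂ ψ) 0 ⟩
    -- At the indices 0 and 1 the sequence `∂ ψ` is `0#` and `⟨ 1 ⟩ * ψ 0`, so only `ψ 0` remains.
    x * ψ 0 + q ^ k * (q * ι * (⟨ 1 ⟩ * ψ 0) + - ι * 0#)
      ≈⟨ solve 5 (λ q ι a y f → a :* ι :* f :+ y :* (q :* ι :* ((:1 :+ q :* :0) :* f) :+ :- ι :* :0)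
            := (a :+ q :* y) :* ι :* f) refl q ι ⟨ suc k ⟩ (q ^ k) (ψ 0) ⟩
    (⟨ suc k ⟩ + q ^ suc k) * ι * ψ 0
      ≈⟨ *-congʳ (*-congʳ (⟨suc⟩ (suc k))) ⟨
    ⟨ suc (suc k) ⟩ * ι * ψ 0
      ∎
    where
    x = ⟨ suc k ⟩ * ι
    ψ = T (V 0 k φ)

  -- The value at [X] = x of the product that `V j k` transposes.
  w : ℕ → ℕ → Carrier → Carrier
  w j zero    x = 1#
  w j (suc k) x = (x - ⟨ j ⟩) * w (suc j) k x

  w-snoc : ∀ j k x → w j (suc k) x ≈ w j k x * (x - ⟨ j ℕ.+ k ⟩)
  w-snoc j zero x = trans (*-comm _ _)
    (*-congˡ (+-congˡ (-‿cong (reflexive (≡.cong ⟨_⟩ (≡.sym (ℕ.+-identityʳ j)))))))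
  w-snoc j (suc k) x = begin
    (x - ⟨ j ⟩) * w (suc j) (suc k) x                      ≈⟨ *-congˡ (w-snoc (suc j) k x) ⟩
    (x - ⟨ j ⟩) * (w (suc j) k x * (x - ⟨ suc j ℕ.+ k ⟩))  ≈⟨ *-assoc _ _ _ ⟨
    w j (suc k) x * (x - ⟨ suc j ℕ.+ k ⟩)
      ≈⟨ *-congˡ (+-congˡ (-‿cong (reflexive (≡.cong ⟨_⟩ (ℕ.+-suc j k))))) ⟨
    w j (suc k) x * (x - ⟨ j ℕ.+ suc k ⟩)                  ∎

  -- An eigensequence of `X` with eigenvalue x is, up to scale, evaluation at [X] = x, so each
  -- multiplication operator acts on it by the value of its polynomial.
  D-eigen : ∀ j {x φ} → (∀ m → X φ m ≈ x * φ m) → ∀ m → D j φ m ≈ (x - ⟨ j ⟩) * φ m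
  D-eigen j {x} {φ} Xφ≈xφ m = begin
    D j φ m
      ≈⟨ solve 4 (λ ι y f g → ι :* g :+ :- (ι :+ y) :* f
            := ι :* g :+ :- ι :* f :- y :* f)
          refl ι ⟨ j ⟩ (φ m) (φ (suc m)) ⟩
    X φ m - ⟨ j ⟩ * φ m          ≈⟨ +-congʳ (Xφ≈xφ m) ⟩
    x * φ m - ⟨ j ⟩ * φ m
      ≈⟨ solve 3 (λ x y f → x :* f :- y :* f := (x :- y) :* f) refl x ⟨ j ⟩ (φ m) ⟩
    (x - ⟨ j ⟩) * φ m            ∎

  step-scale : ∀ a b x φ m → step a b (λ i → x * φ i) m ≈ x * step a b φ m
  step-scale a b x φ m = solve 5 (λ a b x f g → a :* (x :* g) :+ b :* (x :* f)
    := x :* (a :* g :+ b :* f)) refl a b x (φ m) (φ (suc m))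

  V-eigen : ∀ j k {x φ} → (∀ m → X φ m ≈ x * φ m) → ∀ m → V j k φ m ≈ w j k x * φ m
  V-eigen j zero    Xφ≈xφ m = sym (*-identityˡ _)
  V-eigen j (suc k) {x} {φ} Xφ≈xφ m = begin
    D j (V (suc j) k φ) m                  ≈⟨ step-cong _ _ (V-eigen (suc j) k Xφ≈xφ) m ⟩
    D j (λ i → w (suc j) k x * φ i) m      ≈⟨ step-scale _ _ _ φ m ⟩
    w (suc j) k x * D j φ m                ≈⟨ *-congˡ (D-eigen j Xφ≈xφ m) ⟩
    w (suc j) k x * ((x - ⟨ j ⟩) * φ m)
      ≈⟨ solve 3 (λ a b f → a :* (b :* f) := b :* a :* f) refl _ _ _ ⟩
    w j (suc k) x * φ m                    ∎

  X^-eigen : ∀ n {x φ} → (∀ m → X φ m ≈ x * φ m) → ∀ m → X^ n φ m ≈ x ^ n * φ m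
  X^-eigen zero    Xφ≈xφ m = sym (*-identityˡ _)
  X^-eigen (suc n) {x} {φ} Xφ≈xφ m = begin
    X (X^ n φ) m                 ≈⟨ step-cong _ _ (X^-eigen n Xφ≈xφ) m ⟩
    X (λ i → x ^ n * φ i) m      ≈⟨ step-scale _ _ _ φ m ⟩
    x ^ n * X φ m                ≈⟨ *-congˡ (Xφ≈xφ m) ⟩
    x ^ n * (x * φ m)            ≈⟨ solve 3 (λ a b f → a :* (b :* f) := b :* a :* f) refl _ _ _ ⟩
    x ^ suc n * φ m              ∎

  -- The sequence m ↦ m is the functional F ↦ F′(1). For F = [X + 1] [X] ([X] - [1]) ⋯ ([X] - [k])
  -- the factor [X] vanishes at Y = 1 with derivative ι, so F′(1) is ι times the other factors at
  -- [X] = 0, where [X + 1] is 1.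
  TV-id : ∀ k → T (V 0 (suc k) (_×ℕ 1#)) 0 ≈ ι * w 1 k 0#
  TV-id k = begin
    -- The vanishing factor is moved innermost, where it turns m ↦ m into the constant ι, a multiple
    -- of evaluation at Y = 1.
    T (D 0 (V 1 k (_×ℕ 1#))) 0     ≈⟨ step-cong _ _ (V-step-comm 1 k _ _ _) 0 ⟩
    T (V 1 k (D 0 (_×ℕ 1#))) 0     ≈⟨ step-cong _ _ (V-cong 1 k D-id) 0 ⟩
    T (V 1 k (λ _ → ι)) 0          ≈⟨ step-cong _ _ (V-eigen 1 k X-const) 0 ⟩
    T (λ _ → w 1 k 0# * ι) 0
      ≈⟨ modulo (w 1 k 0# * ι) (solve 3 (λ q ι x → q :* ι :* (x :* ι) :+ :- ι :* (x :* ι)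
            := ι :* x :+ x :* ι :* ((q :- :1) :* ι :- :1))
          refl q ι (w 1 k 0#)) ⟩
    ι * w 1 k 0#                   ∎
    where
    D-id : ∀ m → D 0 (_×ℕ 1#) m ≈ ι
    D-id m = solve 2 (λ ι x → ι :* (:1 :+ x) :+ :- (ι :+ :0) :* x := ι) refl ι (m ×ℕ 1#)
    X-const : ∀ m → X (λ _ → ι) m ≈ 0# * ι
    X-const m = solve 1 (λ ι → ι :* ι :+ :- ι :* ι := :0 :* ι) refl ι

  -- Newton expansion of [X]ⁿ and its uniqueness.

  -- stirling j n k is the coefficient of ([X] - [j]) ⋯ ([X] - [j + k - 1]) in [X]ⁿ.
  stirling : ℕ → ℕ → ℕ → Carrier
  stirling j zero    zero    = 1#
  stirling j zero    (suc k) = 0#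
  stirling j (suc n) zero    = ⟨ j ⟩ * stirling j n zero
  stirling j (suc n) (suc k) = stirling (suc j) n k + ⟨ j ⟩ * stirling j n (suc k)

  -- Induction on n by [X] = ([X] - [j]) + [j]: the first part raises the base to j + 1, the second
  -- keeps it. The bound N is independent of n because the two parts expand [X]ⁿ up to N and up to N
  -- + 1; coefficients beyond n are 0.
  newton : ∀ {n N} → n ≤ N → ∀ j φ m →
    X^ n φ m ≈ ∑≤ N (λ k → stirling j n k * V j k φ m)
  newton {N = zero} z≤n j φ m = sym (trans (+-identityʳ _) (*-identityˡ _))
  newton {N = suc N} z≤n j φ m =
    sym (trans (+-cong (*-identityˡ _) (∑-0 N (λ k → zeroˡ _))) (+-identityʳ _))
  newton {suc n} {suc N} (s≤s n≤N) j φ m = begin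
    X ψ m
      ≈⟨ X≋D j ψ m ⟩
    D j ψ m + ⟨ j ⟩ * ψ m
      ≈⟨ +-cong (step-cong _ _ (newton n≤N (suc j) φ) m) (*-congˡ (newton (ℕ.m≤n⇒m≤1+n n≤N) j φ m)) ⟩
    D j (λ i → ∑≤ N (λ k → stirling (suc j) n k * V (suc j) k φ i)) m
      + ⟨ j ⟩ * (stirling j n 0 * φ m + ∑≤ N g)
      ≈⟨ +-cong (step-∑ _ _ N (stirling (suc j) n) (λ k → V (suc j) k φ) m) (distribˡ _ _ _) ⟩
    ∑≤ N f + (⟨ j ⟩ * (stirling j n 0 * φ m) + ⟨ j ⟩ * ∑≤ N g)
      ≈⟨ +-congˡ (+-cong (sym (*-assoc _ _ _)) (sym (∑-*ˡ N _ _))) ⟩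
    ∑≤ N f + (stirling j (suc n) 0 * φ m + ∑≤ N (λ k → ⟨ j ⟩ * g k))
      ≈⟨ solve 3 (λ a b c → a :+ (b :+ c) := b :+ (a :+ c)) refl _ _ _ ⟩
    stirling j (suc n) 0 * φ m + (∑≤ N f + ∑≤ N (λ k → ⟨ j ⟩ * g k))
      ≈⟨ +-congˡ (∑-+ N _ _) ⟨
    stirling j (suc n) 0 * φ m + ∑≤ N (λ k → f k + ⟨ j ⟩ * g k)
      ≈⟨ +-congˡ (∑-cong N (λ k → solve 4 (λ a b c v → a :* v :+ b :* (c :* v)
            := (a :+ b :* c) :* v)
          refl
           (stirling (suc j) n k) ⟨ j ⟩ (stirling j n (suc k)) (V j (suc k) φ m))) ⟩
    ∑≤ (suc N) (λ k → stirling j (suc n) k * V j k φ m)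
      ∎
    where
    ψ = X^ n φ
    f g : ℕ → Carrier
    f k = stirling (suc j) n k * V j (suc k) φ m
    g k = stirling j n (suc k) * V j (suc k) φ m

  newton-eval : ∀ n x → x ^ n ≈ ∑≤ n (λ k → stirling 0 n k * w 0 k x)
  newton-eval n x = begin
    x ^ n                                       ≈⟨ *-identityʳ _ ⟨
    x ^ n * 1#                                  ≈⟨ X^-eigen n geometric 0 ⟨
    X^ n (Y ^_) 0                               ≈⟨ newton (ℕ.≤-refl {n}) 0 (Y ^_) 0 ⟩
    ∑≤ n (λ k → stirling 0 n k * V 0 k (Y ^_) 0)
      ≈⟨ ∑-cong n (λ k → *-congˡ (trans (V-eigen 0 k geometric 0) (*-identityʳ _))) ⟩
    ∑≤ n (λ k → stirling 0 n k * w 0 k x)       ∎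
    where
    -- The Y for which [X] = (Y - 1) ι equals x.
    Y = 1# + (q - 1#) * x
    geometric : ∀ m → X (Y ^_) m ≈ x * Y ^ m
    geometric m = modulo (x * Y ^ m) (solve 4 (λ q ι x y →
      ι :* ((:1 :+ (q :- :1) :* x) :* y) :+ :- ι :* y := x :* y :+ x :* y :* ((q :- :1) :* ι :- :1))
      refl q ι x (Y ^ m))

  Cancelˡ : Carrier → Set (c ⊔ ℓ)
  Cancelˡ a = ∀ {x y} → a * x ≈ a * y → x ≈ y

  module _ (cancel-q : Cancelˡ q) (cancel-⟨suc⟩ : ∀ n → Cancelˡ ⟨ suc n ⟩) where

    cancel-q^ : ∀ n → Cancelˡ (q ^ n)
    cancel-q^ zero    eq = trans (sym (*-identityˡ _)) (trans eq (*-identityˡ _))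
    cancel-q^ (suc n) eq =
      cancel-q^ n (cancel-q (trans (sym (*-assoc _ _ _)) (trans eq (*-assoc _ _ _))))

    cancel-⟨-⟩ : ∀ j i → Cancelˡ (⟨ j ℕ.+ suc i ⟩ - ⟨ j ⟩)
    cancel-⟨-⟩ j i eq = cancel-⟨suc⟩ i (cancel-q^ j (begin
      _  ≈⟨ *-assoc _ _ _ ⟨
      _  ≈⟨ *-congʳ (⟨+⟩ j (suc i)) ⟨
      _  ≈⟨ eq ⟩
      _  ≈⟨ *-congʳ (⟨+⟩ j (suc i)) ⟩
      _  ≈⟨ *-assoc _ _ _ ⟩
      _  ∎))

    -- At the node [j] every term with k > 0 vanishes, which settles k = 0. At a later node the
    -- other terms share the factor [j + i + 1] - [j], which cancels and leaves the same problem
    -- with base j + 1.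
    newton-unique : ∀ n j (a b : ℕ → Carrier) →
      (∀ i → ∑≤ n (λ k → a k * w j k ⟨ j ℕ.+ i ⟩) ≈ ∑≤ n (λ k → b k * w j k ⟨ j ℕ.+ i ⟩)) →
      ∀ k → k ≤ n → a k ≈ b k
    newton-unique zero j a b eq zero z≤n = begin
      a 0                ≈⟨ solve 1 (λ x → x :* :1 :+ :0 := x) refl (a 0) ⟨
      a 0 * 1# + 0#      ≈⟨ eq 0 ⟩
      b 0 * 1# + 0#      ≈⟨ solve 1 (λ x → x :* :1 :+ :0 := x) refl (b 0) ⟩
      b 0                ∎
    newton-unique (suc n) j a b eq = λ
      { zero    _         → a₀≈b₀
      ; (suc k) (s≤s k≤n) → newton-unique n (suc j) (a ∘ suc) (b ∘ suc) tail-eq k k≤n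
      }
      where
      tail : (ℕ → Carrier) → Carrier → Carrier
      tail c x = ∑≤ n (λ k → c (suc k) * w (suc j) k x)

      split : ∀ c x → ∑≤ (suc n) (λ k → c k * w j k x) ≈ c 0 + (x - ⟨ j ⟩) * tail c x
      split c x = +-cong (*-identityʳ _) (trans
        (∑-cong n (λ k → solve 3 (λ a b v → a :* (b :* v) := b :* (a :* v)) refl
          (c (suc k)) (x - ⟨ j ⟩) (w (suc j) k x)))
        (∑-*ˡ n _ _))

      split₀ : ∀ c → ∑≤ (suc n) (λ k → c k * w j k ⟨ j ℕ.+ 0 ⟩) ≈ c 0
      split₀ c = begin
        _                                                   ≈⟨ split c ⟨ j ℕ.+ 0 ⟩ ⟩
        c 0 + (⟨ j ℕ.+ 0 ⟩ - ⟨ j ⟩) * tail c ⟨ j ℕ.+ 0 ⟩    ≈⟨ +-congˡ (*-congʳ (⟨+⟩ j 0)) ⟩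
        c 0 + (q ^ j * 0#) * tail c ⟨ j ℕ.+ 0 ⟩
          ≈⟨ solve 3 (λ x y z → x :+ (y :* :0) :* z := x) refl _ _ _ ⟩
        c 0                                                 ∎

      a₀≈b₀ : a 0 ≈ b 0
      a₀≈b₀ = trans (sym (split₀ a)) (trans (eq 0) (split₀ b))

      tail-eq′ : ∀ i → tail a ⟨ j ℕ.+ suc i ⟩ ≈ tail b ⟨ j ℕ.+ suc i ⟩
      tail-eq′ i = cancel-⟨-⟩ j i (+-cancelˡ (a 0) _ _ (begin
        _  ≈⟨ split a _ ⟨
        _  ≈⟨ eq (suc i) ⟩
        _  ≈⟨ split b _ ⟩
        _  ≈⟨ +-congʳ a₀≈b₀ ⟨
        _  ∎))

      tail-eq : ∀ i → tail a ⟨ suc j ℕ.+ i ⟩ ≈ tail b ⟨ suc j ℕ.+ i ⟩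
      tail-eq i = ≡.subst (λ l → tail a ⟨ l ⟩ ≈ tail b ⟨ l ⟩) (ℕ.+-suc j i) (tail-eq′ i)

  -- Binomial expansion of [X]ⁿ = ιⁿ (Y - 1)ⁿ in powers of Y.

  signedC : ℕ → ℕ → Carrier
  signedC n k = (- 1#) ^ (n ∸ k) * ((n C k) ×ℕ 1#)

  signedC-0 : ∀ n → signedC n 0 ≈ (- 1#) ^ n
  signedC-0 n = begin
    (- 1#) ^ n * ((n C 0) ×ℕ 1#)  ≈⟨ *-congˡ (reflexive (≡.cong (_×ℕ 1#) nC0≡1)) ⟩
    (- 1#) ^ n * (1# + 0#)        ≈⟨ solve 1 (λ x → x :* (:1 :+ :0) := x) refl _ ⟩
    (- 1#) ^ n                    ∎
    where
    nC0≡1 : n C 0 ≡ 1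
    nC0≡1 = ≡.trans (nCk≡nC[n∸k] {0} {n} z≤n) (nCn≡1 n)

  signedC-suc-zero : ∀ n → signedC (suc n) 0 ≈ - signedC n 0
  signedC-suc-zero n = begin
    signedC (suc n) 0    ≈⟨ signedC-0 (suc n) ⟩
    - 1# * (- 1#) ^ n    ≈⟨ solve 1 (λ x → :- :1 :* x := :- x) refl _ ⟩
    - ((- 1#) ^ n)       ≈⟨ -‿cong (signedC-0 n) ⟨
    - signedC n 0        ∎

  signedC-suc-suc : ∀ n k → signedC (suc n) (suc k) ≈ signedC n k - signedC n (suc k)
  signedC-suc-suc n k = begin
    s * ((suc n C suc k) ×ℕ 1#)
      ≈⟨ *-congˡ (reflexive (≡.cong (_×ℕ 1#) (nCk+nC[k+1]≡[n+1]C[k+1] n k))) ⟨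
    s * ((n C k ℕ.+ n C suc k) ×ℕ 1#)
      ≈⟨ *-congˡ (×-homo-+ 1# (n C k) (n C suc k)) ⟩
    s * ((n C k) ×ℕ 1# + (n C suc k) ×ℕ 1#)
      ≈⟨ distribˡ _ _ _ ⟩
    signedC n k + s * ((n C suc k) ×ℕ 1#)
      ≈⟨ +-congˡ flip ⟩
    signedC n k - signedC n (suc k)
      ∎
    where
    s = (- 1#) ^ (n ∸ k)

    flip : s * ((n C suc k) ×ℕ 1#) ≈ - signedC n (suc k)
    -- Subtraction is truncated: `n ∸ k` is the successor of `n ∸ suc k` only when k < n; otherwise
    -- the binomial coefficient is 0.
    flip with ℕ.≤-<-connex (suc k) n
    ... | inj₁ k<n = begin
      (- 1#) ^ (n ∸ k) * b
        ≈⟨ *-congʳ (reflexive (≡.cong ((- 1#) ^_) (ℕ.+-∸-assoc 1 k<n))) ⟩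
      - 1# * (- 1#) ^ (n ∸ suc k) * b
        ≈⟨ solve 2 (λ x y → :- :1 :* x :* y := :- (x :* y)) refl _ _ ⟩
      - signedC n (suc k)                    ∎
      where b = (n C suc k) ×ℕ 1#
    ... | inj₂ n≤k = begin
      s * ((n C suc k) ×ℕ 1#)                ≈⟨ *-congˡ nC≈0 ⟩
      s * 0#                                 ≈⟨ solve 2 (λ x y → x :* :0 := :- (y :* :0)) refl _ _ ⟩
      - ((- 1#) ^ (n ∸ suc k) * 0#)          ≈⟨ -‿cong (*-congˡ nC≈0) ⟨
      - signedC n (suc k)                    ∎
      where
      nC≈0 : (n C suc k) ×ℕ 1# ≈ 0#
      nC≈0 = reflexive (≡.cong (_×ℕ 1#) (k>n⇒nCk≡0 n≤k))

  -- Multiplying by Y - 1 is Pascal's rule with signs. As in `newton`, the induction needs the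
  -- bounds N and N + 1 for the same n.
  X^-binomial : ∀ {n N} → n ≤ N → ∀ φ m →
    X^ n φ m ≈ ι ^ n * ∑≤ N (λ k → signedC n k * φ (m ℕ.+ k))
  X^-binomial {N = N} z≤n φ m = sym (trans (*-identityˡ _) (lemma N))
    where
    head≈ : signedC 0 0 * φ (m ℕ.+ 0) ≈ φ m
    head≈ = trans (*-cong (signedC-0 0) (reflexive (≡.cong φ (ℕ.+-identityʳ m)))) (*-identityˡ _)

    lemma : ∀ N → ∑≤ N (λ k → signedC 0 k * φ (m ℕ.+ k)) ≈ φ m
    lemma zero    = trans (+-identityʳ _) head≈
    lemma (suc N) = trans (+-cong head≈ (∑-0 N (λ k → trans (*-congʳ (zeroʳ _)) (zeroˡ _)))) (+-identityʳ _)
  X^-binomial {suc n} {suc N} (s≤s n≤N) φ m = begin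
    ι * X^ n φ (suc m) + - ι * X^ n φ m
      ≈⟨ +-cong (*-congˡ (X^-binomial n≤N φ (suc m)))
                (*-congˡ (X^-binomial (ℕ.m≤n⇒m≤1+n n≤N) φ m)) ⟩
    ι * (ι ^ n * ∑≤ N (λ k → signedC n k * φ (suc m ℕ.+ k))) + - ι * (ι ^ n * (h + ∑≤ N g))
      ≈⟨ +-congʳ (*-congˡ (*-congˡ (∑-cong N (λ k → *-congˡ (reflexive (≡.cong φ (≡.sym (ℕ.+-suc m k)))))))) ⟩
    ι * (ι ^ n * ∑≤ N f) + - ι * (ι ^ n * (h + ∑≤ N g))
      ≈⟨ solve 5 (λ ι y a h b → ι :* (y :* a) :+ :- ι :* (y :* (h :+ b))
            := (ι :* y) :* (:- h :+ (a :+ :- :1 :* b))) refl ι (ι ^ n) (∑≤ N f) h (∑≤ N g) ⟩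
    ι ^ suc n * (- h + (∑≤ N f + - 1# * ∑≤ N g))
      ≈⟨ *-congˡ (+-congˡ (+-congˡ (∑-*ˡ N (- 1#) g))) ⟨
    ι ^ suc n * (- h + (∑≤ N f + ∑≤ N (λ k → - 1# * g k)))
      ≈⟨ *-congˡ (+-congˡ (∑-+ N _ _)) ⟨
    ι ^ suc n * (- h + ∑≤ N (λ k → f k + - 1# * g k))
      ≈⟨ *-congˡ (+-cong head≈ (∑-cong N tail≈)) ⟩
    ι ^ suc n * ∑≤ (suc N) (λ k → signedC (suc n) k * φ (m ℕ.+ k))
      ∎
    where
    h = signedC n 0 * φ (m ℕ.+ 0)
    f g : ℕ → Carrier
    f k = signedC n k * φ (m ℕ.+ suc k)
    g k = signedC n (suc k) * φ (m ℕ.+ suc k)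

    head≈ : - h ≈ signedC (suc n) 0 * φ (m ℕ.+ 0)
    head≈ = trans (-‿distribˡ-* _ _) (*-congʳ (sym (signedC-suc-zero n)))

    tail≈ : ∀ k → f k + - 1# * g k ≈ signedC (suc n) (suc k) * φ (m ℕ.+ suc k)
    tail≈ k = trans
      (solve 3 (λ a b v → a :* v :+ :- :1 :* (b :* v) := (a :- b) :* v) refl
        (signedC n k) (signedC n (suc k)) (φ (m ℕ.+ suc k)))
      (*-congʳ (sym (signedC-suc-suc n k)))

-- The quotient is truncated, so the proof splits off a summand that 2 divides exactly.
triangular-suc : ∀ k → suc k ℕ.* k ℕ./ 2 ≡ k ℕ.+ k ℕ.* (k ∸ 1) ℕ./ 2
triangular-suc zero    = ≡.refl
triangular-suc (suc m) = begin
  suc (suc m) ℕ.* suc m ℕ./ 2                ≡⟨ ≡.cong (ℕ._/ 2) (solve 1 (λ m →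
                                                (con 2 :+ m) :* (con 1 :+ m)
                                                  := (con 1 :+ m) :* con 2 :+ (con 1 :+ m) :* m) ≡.refl m) ⟩
  (suc m ℕ.* 2 ℕ.+ suc m ℕ.* m) ℕ./ 2        ≡⟨ ℕ.+-distrib-/-∣ˡ (suc m ℕ.* m) (divides (suc m) ≡.refl) ⟩
  suc m ℕ.* 2 ℕ./ 2 ℕ.+ suc m ℕ.* m ℕ./ 2    ≡⟨ ≡.cong (ℕ._+ suc m ℕ.* m ℕ./ 2) (ℕ.m*n/n≡m (suc m) 2) ⟩
  suc m ℕ.+ suc m ℕ.* m ℕ./ 2                ∎
  where
  open ≡.≡-Reasoning
  open +-*-Solver

-- The real numbers: q-numbers, falling factorials and q-factorials.

module _ {c ℓ₁ ℓ₂} (ℝ : Reals c ℓ₁ ℓ₂) (q : Reals.Carrier ℝ)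
  (0<q : Reals._<_ ℝ (Reals.0# ℝ) q) (q#1 : Reals._#_ ℝ q (Reals.1# ℝ))
  (pow : Reals.Carrier ℝ → Reals.Carrier ℝ) (isRealPower : IsRealPower ℝ q pow) where

  open Reals ℝ
  open QCalculus ℝ q 0<q q#1 pow isRealPower
  open IsRealPower isRealPower
  open FiniteSums commutativeRing
  open ℤSolver commutativeRing
  open Exp semiring using (^-congˡ; ^-homo-*)
  open SetoidReasoning setoid

  private
    ι : Carrier
    ι = 1# / (q - 1#) ⟨ q-1#0 ⟩

  open Umbral commutativeRing q ι (/-inverse (q - 1#) q-1#0)

  #0⇒cancelˡ : ∀ {x} → x # 0# → Cancelˡ x
  #0⇒cancelˡ {x} x#0 {y} {z} xy≈xz = begin
    y              ≈⟨ expand y ⟩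
    u * (x * y)    ≈⟨ *-congˡ xy≈xz ⟩
    u * (x * z)    ≈⟨ expand z ⟨
    z              ∎
    where
    u = 1# / x ⟨ x#0 ⟩
    expand : ∀ y → y ≈ u * (x * y)
    expand y = begin
      y              ≈⟨ *-identityˡ y ⟨
      1# * y         ≈⟨ *-congʳ (/-inverse x x#0) ⟨
      x * u * y      ≈⟨ solve 3 (λ x u y → x :* u :* y := u :* (x :* y)) refl x u y ⟩
      u * (x * y)    ∎

  cancel-q : Cancelˡ q
  cancel-q = #0⇒cancelˡ (#-sym (<⇒# 0<q))

  pow-0 : pow 0# ≈ 1#
  pow-0 = cancel-q (begin
    q * pow 0#         ≈⟨ *-congʳ pow-1 ⟨
    pow 1# * pow 0#    ≈⟨ pow-+ 1# 0# ⟨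
    pow (1# + 0#)      ≈⟨ pow-cong (+-identityʳ 1#) ⟩
    pow 1#             ≈⟨ pow-1 ⟩
    q                  ≈⟨ *-identityʳ q ⟨
    q * 1#             ∎)

  pow-fromℕ : ∀ n → pow (fromℕ n) ≈ q ^ n
  pow-fromℕ zero    = pow-0
  pow-fromℕ (suc n) = trans (pow-+ 1# (fromℕ n)) (*-cong pow-1 (pow-fromℕ n))

  []-closed : ∀ x → [ x ] ≈ (pow x - 1#) * ι
  -- `[_]` multiplies by the bare inverse, whereas ι carries a factor `1#` from `_/_⟨_⟩`.
  []-closed x = *-congˡ (sym (*-identityˡ _))

  []-cong : ∀ {x y} → x ≈ y → [ x ] ≈ [ y ]
  []-cong x≈y = *-congʳ (+-congʳ (pow-cong x≈y))

  [fromℕ] : ∀ n → [ fromℕ n ] ≈ ⟨ n ⟩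
  [fromℕ] n = begin
    [ fromℕ n ]                  ≈⟨ []-closed _ ⟩
    (pow (fromℕ n) - 1#) * ι     ≈⟨ *-congʳ (+-congʳ (pow-fromℕ n)) ⟩
    (q ^ n - 1#) * ι             ≈⟨ ⟨⟩-closed n ⟨
    ⟨ n ⟩                        ∎

  q^k*[x-k] : ∀ k x → q ^ k * [ x - fromℕ k ] ≈ [ x ] - ⟨ k ⟩
  q^k*[x-k] k x = begin
    q ^ k * [ x - fromℕ k ]
      ≈⟨ *-congˡ ([]-closed _) ⟩
    q ^ k * ((pow (x - fromℕ k) - 1#) * ι)
      ≈⟨ solve 3 (λ a b ι → a :* ((b :- con (+ 1)) :* ι)
            := (b :* a :- con (+ 1)) :* ι :- (a :- con (+ 1)) :* ι) refl (q ^ k) (pow (x - fromℕ k)) ι ⟩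
    (pow (x - fromℕ k) * q ^ k - 1#) * ι - (q ^ k - 1#) * ι
      ≈⟨ +-cong (*-congʳ (+-congʳ pow-x)) (-‿cong (sym (⟨⟩-closed k))) ⟩
    (pow x - 1#) * ι - ⟨ k ⟩
      ≈⟨ +-congʳ ([]-closed x) ⟨
    [ x ] - ⟨ k ⟩
      ∎
    where
    pow-x : pow (x - fromℕ k) * q ^ k ≈ pow x
    pow-x = begin
      pow (x - fromℕ k) * q ^ k             ≈⟨ *-congˡ (pow-fromℕ k) ⟨
      pow (x - fromℕ k) * pow (fromℕ k)     ≈⟨ pow-+ _ _ ⟨
      pow (x - fromℕ k + fromℕ k)
        ≈⟨ pow-cong (solve 2 (λ x y → x :- y :+ y := x) refl x (fromℕ k)) ⟩
      pow x                                 ∎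

  -- Each factor [x - i] takes one qⁱ to become [x] - [i], and the exponents i < k add up to k (k -
  -- 1) / 2. So the identities defining the q-Stirling numbers are Newton expansions at the nodes
  -- [i].
  falling≈w : ∀ k x {y} → [ x ] ≈ y → q ^ (k ℕ.* (k ∸ 1) ℕ./ 2) * [ x ]↓ k ≈ w 0 k y
  falling≈w zero    x     [x]≈y = *-identityˡ 1#
  falling≈w (suc k) x {y} [x]≈y = begin
    q ^ (suc k ℕ.* k ℕ./ 2) * ([ x ]↓ k * [ x - fromℕ k ])
      ≈⟨ *-congʳ (trans (reflexive (≡.cong (q ^_) (triangular-suc k))) (^-homo-* q k t)) ⟩
    q ^ k * q ^ t * ([ x ]↓ k * [ x - fromℕ k ])
      ≈⟨ solve 4 (λ a b f g → a :* b :* (f :* g) := b :* f :* (a :* g)) refl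
           (q ^ k) (q ^ t) ([ x ]↓ k) [ x - fromℕ k ] ⟩
    q ^ t * [ x ]↓ k * (q ^ k * [ x - fromℕ k ])
      ≈⟨ *-cong (falling≈w k x [x]≈y) (trans (q^k*[x-k] k x) (+-congʳ [x]≈y)) ⟩
    w 0 k y * (y - ⟨ k ⟩)
      ≈⟨ w-snoc 0 k y ⟨
    w 0 (suc k) y
      ∎
    where t = k ℕ.* (k ∸ 1) ℕ./ 2

  -- For x = k this gives [k + 1]! = [k + 1] [k]!, which the recursion on the last factor does not
  -- show.
  falling-suc : ∀ k x → [ 1# + x ]↓ suc k ≈ [ 1# + x ] * [ x ]↓ k
  falling-suc zero x = trans (*-identityˡ _) (trans ([]-cong (x-0≈x _)) (sym (*-identityʳ _)))
  falling-suc (suc k) x = begin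
    [ 1# + x ]↓ suc k * [ 1# + x - (1# + fromℕ k) ]
      ≈⟨ *-cong (falling-suc k x) ([]-cong (solve 2 (λ x y →
           con (+ 1) :+ x :- (con (+ 1) :+ y) := x :- y) refl x (fromℕ k))) ⟩
    [ 1# + x ] * [ x ]↓ k * [ x - fromℕ k ]
      ≈⟨ *-assoc _ _ _ ⟩
    [ 1# + x ] * [ x ]↓ suc k
      ∎

  w-1-0 : ∀ k → w 1 k 0# ≈ (- 1#) ^ k * [ k ]!
  w-1-0 zero    = sym (*-identityˡ 1#)
  w-1-0 (suc k) = begin
    w 1 (suc k) 0#                                  ≈⟨ w-snoc 1 k 0# ⟩
    w 1 k 0# * (0# - ⟨ suc k ⟩)
      ≈⟨ *-cong (w-1-0 k) (+-congˡ (-‿cong (sym ([fromℕ] (suc k))))) ⟩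
    (- 1#) ^ k * [ k ]! * (0# - [ fromℕ (suc k) ])  ≈⟨ solve 3 (λ s f b → s :* f :* (con (+ 0) :- b)
                                                         := :- con (+ 1) :* s :* (b :* f)) refl
                                                         ((- 1#) ^ k) [ k ]! [ fromℕ (suc k) ] ⟩
    (- 1#) ^ suc k * ([ fromℕ (suc k) ] * [ k ]!)   ≈⟨ *-congˡ (falling-suc k (fromℕ k)) ⟨
    (- 1#) ^ suc k * [ suc k ]!                     ∎

  -- The functional L with moments (m + 1)/[m + 1].

  μ : Seq
  μ k = fromℕ (suc k) / [ fromℕ (suc k) ] ⟨ [1+ k ]#0 ⟩

  -- This is L(∂F) = F′(1): `fromℕ` lists the derivatives of Yᵐ at Y = 1.
  ∂μ : ∂ μ ≋ fromℕ
  ∂μ zero    = refl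
  ∂μ (suc k) = begin
    ⟨ suc k ⟩ * μ k
      ≈⟨ *-congʳ ([fromℕ] (suc k)) ⟨
    b * μ k
      ≈⟨ solve 3 (λ b f u → b :* (f :* u) := f :* (b :* (con (+ 1) :* u))) refl b (fromℕ (suc k))
           (proj₁ (#⇒invertible [1+ k ]#0)) ⟩
    fromℕ (suc k) * (b * (1# / b ⟨ [1+ k ]#0 ⟩))
      ≈⟨ *-congˡ (/-inverse b [1+ k ]#0) ⟩
    fromℕ (suc k) * 1#
      ≈⟨ *-identityʳ _ ⟩
    fromℕ (suc k)
      ∎
    where b = [ fromℕ (suc k) ]

  β≈X^μ : ∀ n → β n ≈ X^ n μ 0
  β≈X^μ n = begin
    β n
      ≈⟨ *-congˡ (reflexive (∑≤≡sum n (λ k → signedC n k * μ k))) ⟨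
    ι ^ n * ∑≤ n (λ k → signedC n k * μ k)    ≈⟨ X^-binomial (ℕ.≤-refl {n}) μ 0 ⟨
    X^ n μ 0                                  ∎

  -- L(∂F) for F = [X + 1] [X] ⋯ ([X] - [k]) is computed twice, by `TV-∂` as [k + 2] ι t and by
  -- `TV-id` as ι times `w 1 k 0#`. Multiplying by u = 1/[k + 2] and by q - 1 isolates t.
  TV-μ : ∀ k → T (V 0 k μ) 0 ≈ (- 1#) ^ k * ([ k ]! / [ fromℕ (suc (suc k)) ] ⟨ [1+ suc k ]#0 ⟩)
  TV-μ k = begin
    t                                       ≈⟨ *-identityˡ t ⟨
    1# * t                                  ≈⟨ *-congʳ (/-inverse b [1+ suc k ]#0) ⟨
    b * (1# * u) * t                        ≈⟨ *-congʳ (*-congʳ ([fromℕ] (suc (suc k)))) ⟩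
    ⟨ suc (suc k) ⟩ * (1# * u) * t
      ≈⟨ modulo (- (⟨ suc (suc k) ⟩ * u * t)) (solve 5 (λ q ι b u t →
                                                 b :* (con (+ 1) :* u) :* t
                                                   := u :* (q :- con (+ 1)) :* (b :* ι :* t)
                                                      :+ :- (b :* u :* t) :* ((q :- con (+ 1)) :* ι :- con (+ 1)))
                                                 refl q ι ⟨ suc (suc k) ⟩ u t) ⟩
    u * (q - 1#) * (⟨ suc (suc k) ⟩ * ι * t) ≈⟨ *-congˡ (TV-∂ k μ) ⟨
    u * (q - 1#) * T (V 0 (suc k) (∂ μ)) 0  ≈⟨ *-congˡ (step-cong _ _ (V-cong 0 (suc k) ∂μ) 0) ⟩
    u * (q - 1#) * T (V 0 (suc k) fromℕ) 0  ≈⟨ *-congˡ (TV-id k) ⟩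
    u * (q - 1#) * (ι * w 1 k 0#)           ≈⟨ modulo (u * w 1 k 0#) (solve 4 (λ q ι u w →
                                                 u :* (q :- con (+ 1)) :* (ι :* w)
                                                   := w :* u :+ u :* w :* ((q :- con (+ 1)) :* ι :- con (+ 1)))
                                                 refl q ι u (w 1 k 0#)) ⟩
    w 1 k 0# * u                            ≈⟨ *-congʳ (w-1-0 k) ⟩
    (- 1#) ^ k * [ k ]! * u                 ≈⟨ *-assoc _ _ _ ⟩
    (- 1#) ^ k * ([ k ]! * u)               ∎
    where
    t = T (V 0 k μ) 0
    b = [ fromℕ (suc (suc k)) ]
    u = proj₁ (#⇒invertible [1+ suc k ]#0)

  -- Identification of the q-Stirling numbers and the final summation.

  module _ (S : ℕ → ℕ → Carrier) (isS : IsQStirling₂ S) where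

    S-eval : ∀ n i → ⟨ i ⟩ ^ n ≈ ∑≤ n (λ k → S n k * w 0 k ⟨ i ⟩)
    S-eval n i = begin
      ⟨ i ⟩ ^ n                                 ≈⟨ ^-congˡ n ([fromℕ] i) ⟨
      [ x ] ^ n                                 ≈⟨ isS n x ⟩
      ∑[ k ≤ n ] f k                            ≈⟨ reflexive (∑≤≡sum n f) ⟨
      ∑≤ n f                                    ≈⟨ ∑-cong n (λ k → trans
                                                     (solve 3 (λ a s g → a :* s :* g
                                                           := s :* (a :* g))
                                                         refl
                                                       (q ^ (k ℕ.* (k ∸ 1) ℕ./ 2)) (S n k) ([ x ]↓ k))
                                                     (*-congˡ (falling≈w k x ([fromℕ] i)))) ⟩
      ∑≤ n (λ k → S n k * w 0 k ⟨ i ⟩)          ∎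
      where
      x = fromℕ i
      f : ℕ → Carrier
      f k = q ^ (k ℕ.* (k ∸ 1) ℕ./ 2) * S n k * [ x ]↓ k

    -- Both coefficient families expand the same powers at all nodes [i], and differences of nodes
    -- cancel because q and every [k + 1] are apart from 0.
    stirling≈S : ∀ n k → k ≤ n → stirling 0 n k ≈ S n k
    stirling≈S n = newton-unique cancel-q
      (λ k → #0⇒cancelˡ (#-congʳ ([fromℕ] (suc k)) [1+ k ]#0)) n 0 (stirling 0 n) (S n)
      (λ i → trans (sym (newton-eval n ⟨ i ⟩)) (S-eval n i))

    β+qβ≈∑ : ∀ n → β n + q * β (suc n) ≈
      ∑[ k ≤ n ] ((- 1#) ^ k * ([ k ]! / [ fromℕ (suc (suc k)) ] ⟨ [1+ suc k ]#0 ⟩) * S n k)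
    β+qβ≈∑ n = begin
      β n + q * β (suc n)
        ≈⟨ +-cong (β≈X^μ n) (*-congˡ (β≈X^μ (suc n))) ⟩
      X^ n μ 0 + q * X (X^ n μ) 0
        -- The left side is L((1 + q [X]) [X]ⁿ), and 1 + q [X] = [X + 1].
        ≈⟨ T≋1+qX (X^ n μ) 0 ⟨
      T (X^ n μ) 0
        ≈⟨ step-cong _ _ (newton (ℕ.≤-refl {n}) 0 μ) 0 ⟩
      T (λ i → ∑≤ n (λ k → stirling 0 n k * V 0 k μ i)) 0
        ≈⟨ step-∑ _ _ n (stirling 0 n) (λ k → V 0 k μ) 0 ⟩
      ∑≤ n (λ k → stirling 0 n k * T (V 0 k μ) 0)
        -- `S n k` is determined only for k ≤ n, hence the congruence restricted to the range of
        -- summation.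
        ≈⟨ ∑-cong-≤ n (λ k k≤n → trans (*-cong (stirling≈S n k k≤n) (TV-μ k)) (*-comm _ _)) ⟩
      ∑≤ n f
        ≈⟨ reflexive (∑≤≡sum n f) ⟩
      ∑[ k ≤ n ] f k
        ∎
      where
      f : ℕ → Carrier
      f k = (- 1#) ^ k * ([ k ]! / [ fromℕ (suc (suc k)) ] ⟨ [1+ suc k ]#0 ⟩) * S n k

corollary2p28 : ∀ {c ℓ₁ ℓ₂} (ℝ : Reals c ℓ₁ ℓ₂) → let open Reals ℝ in
    (q : Carrier) (0<q : 0# < q) (q#1 : q # 1#)
    (pow : Carrier → Carrier) (isRealPower : IsRealPower ℝ q pow) →
    let open QCalculus ℝ q 0<q q#1 pow isRealPower in
    (S : ℕ → ℕ → Carrier) → IsQStirling₂ S →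
    ∀ n → β n + q * β (suc n) ≈
    ∑[ k ≤ n ] ((- 1#) ^ k * ([ k ]! / [ fromℕ (suc (suc k)) ] ⟨ [1+ suc k ]#0 ⟩) * S n k)
corollary2p28 = β+qβ≈∑
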